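{- $$b_4(2) = 19.$$
   Context: For a positive integer $k$, $b_k(2)$ denotes the diagonal multicolor bipartite Ramsey number for the quadrilateral: the least positive integer $b$ such that any coloring of the edges of the complete bipartite graph $K_{b,b}$ with $k$ colors contains a monochromatic copy of $K_{2,2}=C_4$ (a 4-cycle all of whose edges have the same color). -}

module Defs where

open import Data.Nat using (ℕ; _≤_; _<_)
open import Data.Fin using (Fin)
open import Data.Product using (_×_; ∃-syntax)
open import Relation.Binary.PropositionalEquality using (_≡_; _≢_)

-- The edges of K_{b,b} are the pairs (left vertex , right vertex), so they are
-- indexed by Fin b × Fin b (curried here).
EdgeColouring : ℕ → ℕ → Set
EdgeColouring k b = Fin b → Fin b → Fin k

-- A 4-cycle of K_{b,b} alternates between the two sides: it is u v u′ v′ with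
-- u ≢ u′ on the left and v ≢ v′ on the right.
HasMonochromaticC₄ : ∀ {k b} → EdgeColouring k b → Set
HasMonochromaticC₄ {k} {b} χ =
  ∃[ u ] ∃[ u′ ] ∃[ v ] ∃[ v′ ] ∃[ c ]
    u ≢ u′ × v ≢ v′ ×
    χ u v ≡ c × χ u′ v ≡ c × χ u′ v′ ≡ c × χ u v′ ≡ c

Unavoidable : ℕ → ℕ → Set
Unavoidable k b = (χ : EdgeColouring k b) → HasMonochromaticC₄ χ

-- "b_k(2) = b".  A relation rather than a function of k, since the latter would
-- need a proof that such a b exists; b is determined by k (antisymmetry of ≤).
record IsBipartiteRamseyNumber (k b : ℕ) : Set where
  field
    positive    : 0 < b
    unavoidable : Unavoidable k b
    least       : ∀ m → 0 < m → Unavoidable k m → b ≤ m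

{-# OPTIONS --safe #-}
-- Upper bound: if one colour class of K_{19,19} is C₄-free with e edges and
-- right degrees d(v), counting ordered pairs of left vertices with a common
-- neighbour gives ∑ d(v)² ≤ e + 19·18, while (d − 4)(d − 5) ≥ 0 gives
-- 9e ≤ ∑ d(v)² + 19·20.  Hence 8e ≤ 722, so e ≤ 90, and four such classes have
-- at most 360 < 361 edges.
--
-- Lower bound: an explicit colouring of K_{18,18} invariant under ℤ₃ × ℤ₃
-- acting on each side with two regular orbits.
module Submission where

open import Defs

import Algebra.Properties.Semiring.Sum as Sum
open import Data.Bool using (Bool; true; false)
open import Data.Empty using (⊥)
open import Data.Fin using (Fin; zero; suc; remQuot; punchIn; inject≤; _≟_)
open import Data.Fin.Patterns using (0F; 1F; 2F; 3F)
open import Data.Fin.Properties using (all?; any?; punchInᵢ≢i; inject≤-injective)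
open import Data.Nat using (ℕ; zero; suc; _+_; _*_; _≤_; z≤n; s≤s)
open import Data.Nat.Properties hiding (_≟_)
open import Data.Nat.Tactic.RingSolver using (solve-∀)
open import Data.Product using (_,_)
open import Data.Sum using (inj₁; inj₂)
open import Data.Vec using (Vec; []; _∷_; lookup)
open import Function using (_∘_)
open import Relation.Binary.PropositionalEquality
open import Relation.Nullary using (¬_; Dec; does; yes; no; contradiction)
open import Relation.Nullary.Decidable using (_×-dec_; _→-dec_; ¬?; from-yes; decidable-stable)

open Sum +-*-semiring
  using (sum; sum-syntax; sum-cong-≗; sum-remove; sum-replicate-zero;
         ∑-distrib-+; ∑-comm; *-distribˡ-sum; *-distribʳ-sum)

-- Finite sums of natural numbers

∑-mono-≤ : ∀ {n} {f g : Fin n → ℕ} → (∀ i → f i ≤ g i) → sum f ≤ sum g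
∑-mono-≤ {zero}  f≤g = z≤n
∑-mono-≤ {suc n} f≤g = +-mono-≤ (f≤g zero) (∑-mono-≤ (f≤g ∘ suc))

∑-const : ∀ n x → ∑[ i < n ] x ≡ n * x
∑-const zero    x = refl
∑-const (suc n) x = cong (x +_) (∑-const n x)

∑-≤-const : ∀ {n} {f : Fin n → ℕ} x → (∀ i → f i ≤ x) → sum f ≤ n * x
∑-≤-const {n} x f≤x = ≤-trans (∑-mono-≤ f≤x) (≤-reflexive (∑-const n x))

∑-zero : ∀ {n} {f : Fin n → ℕ} → (∀ i → f i ≡ 0) → sum f ≡ 0
∑-zero {n} f≡0 = trans (sum-cong-≗ f≡0) (sum-replicate-zero n)

-- Meant for a row of codegrees: the diagonal entry `f i` may be large and is kept apart, the other
-- `m` entries are small.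
∑-≤1-off : ∀ {m} (f : Fin (suc m) → ℕ) i → (∀ j → i ≢ j → f j ≤ 1) → sum f ≤ f i + m
∑-≤1-off {m} f i f≤1 = begin
  sum f                       ≡⟨ sum-remove {i = i} f ⟩
  f i + sum (f ∘ punchIn i)   ≤⟨ +-monoʳ-≤ (f i) (∑-≤-const 1 λ j → f≤1 (punchIn i j) (punchInᵢ≢i i j ∘ sym)) ⟩
  f i + m * 1                 ≡⟨ cong (f i +_) (*-identityʳ m) ⟩
  f i + m                     ∎
  where open ≤-Reasoning

∑*∑ : ∀ {m n} (f : Fin m → ℕ) (g : Fin n → ℕ) → sum f * sum g ≡ ∑[ i < m ] ∑[ j < n ] (f i * g j)
∑*∑ f g = trans (*-distribʳ-sum (sum g) f) (sum-cong-≗ λ i → *-distribˡ-sum (f i) g)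

-- Indicators

𝟙 : Bool → ℕ
𝟙 true  = 1
𝟙 false = 0

𝟙-idem : ∀ b → 𝟙 b * 𝟙 b ≡ 𝟙 b
𝟙-idem true  = refl
𝟙-idem false = refl

∑-𝟙-≟ : ∀ {k} (i : Fin k) → ∑[ c < k ] 𝟙 (does (i ≟ c)) ≡ 1
∑-𝟙-≟ {suc k} zero    = cong suc (∑-zero {k} λ _ → refl)
∑-𝟙-≟ {suc k} (suc i) = ∑-𝟙-≟ i

-- The sum counts common neighbours of two vertices with neighbourhoods `p` and `q`; once one is
-- found, `unique` makes all later terms vanish.
∑-𝟙*𝟙≤1 : ∀ {n} (p q : Fin n → Bool) →
  (∀ i j → i ≢ j → p i ≡ true → q i ≡ true → p j ≡ true → q j ≡ true → ⊥) →
  ∑[ i < n ] (𝟙 (p i) * 𝟙 (q i)) ≤ 1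
∑-𝟙*𝟙≤1 {zero}  p q unique = z≤n
∑-𝟙*𝟙≤1 {suc n} p q unique with p zero in p₀ | q zero in q₀
... | false | _     = ∑-𝟙*𝟙≤1 (p ∘ suc) (q ∘ suc) λ i j i≢j → unique (suc i) (suc j) λ { refl → i≢j refl }
... | true  | false = ∑-𝟙*𝟙≤1 (p ∘ suc) (q ∘ suc) λ i j i≢j → unique (suc i) (suc j) λ { refl → i≢j refl }
... | true  | true  = ≤-reflexive (cong suc (∑-zero vanish))
  where
  vanish : ∀ i → 𝟙 (p (suc i)) * 𝟙 (q (suc i)) ≡ 0
  vanish i with p (suc i) in pᵢ | q (suc i) in qᵢ
  ... | false | _     = refl
  ... | true  | false = refl
  ... | true  | true  = contradiction qᵢ (unique zero (suc i) (λ ()) p₀ q₀ pᵢ)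

-- Edges of C₄-free bipartite graphs

C₄-Free : ∀ {m n} → (Fin m → Fin n → Bool) → Set
C₄-Free A = ∀ u u′ v v′ → u ≢ u′ → v ≢ v′ →
  A u v ≡ true → A u′ v ≡ true → A u v′ ≡ true → A u′ v′ ≡ true → ⊥

edges : ∀ {m n} → (Fin m → Fin n → Bool) → ℕ
edges {m} {n} A = ∑[ u < m ] ∑[ v < n ] 𝟙 (A u v)

-- (x − d)(x − d − 1) ≥ 0 without subtraction.
tangent : ∀ d x → (2 * d + 1) * x ≤ x * x + d * suc d
tangent d x with ≤-<-connex x d
-- In both cases (x - d)(x - d - 1) equals `k * suc k`: here k = d - x, below k = x - d - 1.
... | inj₁ x≤d with k , refl ← m≤n⇒∃[o]m+o≡n x≤d =
  ≤-trans (m≤m+n _ (k * suc k)) (≤-reflexive (identity x k))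
  where
  identity : ∀ x k → (2 * (x + k) + 1) * x + k * suc k ≡ x * x + (x + k) * suc (x + k)
  identity = solve-∀
... | inj₂ d<x with k , refl ← m≤n⇒∃[o]m+o≡n d<x =
  ≤-trans (m≤m+n _ (k * suc k)) (≤-reflexive (identity d k))
  where
  identity : ∀ d k → (2 * d + 1) * (suc d + k) + k * suc k ≡ (suc d + k) * (suc d + k) + d * suc d
  identity = solve-∀

module _ {m n} (A : Fin (suc m) → Fin n → Bool) where

  degree : Fin n → ℕ
  degree v = ∑[ u < suc m ] 𝟙 (A u v)

  codegree : Fin (suc m) → Fin (suc m) → ℕ
  codegree u u′ = ∑[ v < n ] (𝟙 (A u v) * 𝟙 (A u′ v))

  -- Both sides count the triples (u, u′, v) with `v` adjacent to `u` and `u′`, where u = u′ is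
  -- allowed.
  ∑-degree² : ∑[ v < n ] (degree v * degree v) ≡ ∑[ u < suc m ] ∑[ u′ < suc m ] codegree u u′
  ∑-degree² = begin
    ∑[ v < n ] (degree v * degree v)
      ≡⟨ sum-cong-≗ (λ v → ∑*∑ (λ u → 𝟙 (A u v)) (λ u → 𝟙 (A u v))) ⟩
    ∑[ v < n ] ∑[ u < suc m ] ∑[ u′ < suc m ] (𝟙 (A u v) * 𝟙 (A u′ v))
      ≡⟨ ∑-comm (λ v u → ∑[ u′ < suc m ] (𝟙 (A u v) * 𝟙 (A u′ v))) ⟩
    ∑[ u < suc m ] ∑[ v < n ] ∑[ u′ < suc m ] (𝟙 (A u v) * 𝟙 (A u′ v))
      ≡⟨ sum-cong-≗ (λ u → ∑-comm λ v u′ → 𝟙 (A u v) * 𝟙 (A u′ v)) ⟩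
    ∑[ u < suc m ] ∑[ u′ < suc m ] codegree u u′ ∎
    where open ≡-Reasoning

  -- The diagonal codegrees are the left degrees and add up to `edges A`; two distinct left vertices
  -- share at most one neighbour, which leaves at most `m` more per row.
  ∑-degree²-≤ : C₄-Free A → ∑[ v < n ] (degree v * degree v) ≤ edges A + suc m * m
  ∑-degree²-≤ free = begin
    ∑[ v < n ] (degree v * degree v)
      ≡⟨ ∑-degree² ⟩
    ∑[ u < suc m ] ∑[ u′ < suc m ] codegree u u′
      ≤⟨ ∑-mono-≤ (λ u → ∑-≤1-off (codegree u) u λ u′ u≢u′ →
           ∑-𝟙*𝟙≤1 (A u) (A u′) λ v v′ → free u u′ v v′ u≢u′) ⟩
    ∑[ u < suc m ] (codegree u u + m)
      ≡⟨ ∑-distrib-+ (λ u → codegree u u) (λ _ → m) ⟩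
    ∑[ u < suc m ] codegree u u + ∑[ u < suc m ] m
      ≡⟨ cong₂ _+_ (sum-cong-≗ λ u → sum-cong-≗ λ v → 𝟙-idem (A u v)) (∑-const (suc m) m) ⟩
    edges A + suc m * m ∎
    where open ≤-Reasoning

  -- Summing `tangent` over the right vertices bounds `edges A` linearly by the sum of squared
  -- degrees; one copy of `edges A` then cancels.
  C₄-Free⇒edges-≤ : C₄-Free A → ∀ d → 2 * d * edges A ≤ suc m * m + n * (d * suc d)
  C₄-Free⇒edges-≤ free d = +-cancelʳ-≤ (edges A) _ _ (begin
    2 * d * edges A + edges A
      ≡⟨ distrib (2 * d) (edges A) ⟩
    (2 * d + 1) * edges A
      ≡⟨ cong ((2 * d + 1) *_) (∑-comm λ u v → 𝟙 (A u v)) ⟩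
    (2 * d + 1) * ∑[ v < n ] degree v
      ≡⟨ *-distribˡ-sum (2 * d + 1) degree ⟩
    ∑[ v < n ] ((2 * d + 1) * degree v)
      ≤⟨ ∑-mono-≤ (λ v → tangent d (degree v)) ⟩
    ∑[ v < n ] (degree v * degree v + d * suc d)
      ≡⟨ ∑-distrib-+ (λ v → degree v * degree v) (λ _ → d * suc d) ⟩
    ∑[ v < n ] (degree v * degree v) + ∑[ v < n ] (d * suc d)
      ≤⟨ +-mono-≤ (∑-degree²-≤ free) (≤-reflexive (∑-const n (d * suc d))) ⟩
    edges A + suc m * m + n * (d * suc d)
      ≡⟨ rotate (edges A) (suc m * m) (n * (d * suc d)) ⟩
    suc m * m + n * (d * suc d) + edges A ∎)
    where
    open ≤-Reasoning
    distrib : ∀ x e → x * e + e ≡ (x + 1) * e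
    distrib = solve-∀
    rotate : ∀ x y z → x + y + z ≡ y + z + x
    rotate = solve-∀

-- Colourings

hasMonochromaticC₄? : ∀ {k b} (χ : EdgeColouring k b) → Dec (HasMonochromaticC₄ χ)
hasMonochromaticC₄? χ = any? λ u → any? λ u′ → any? λ v → any? λ v′ → any? λ c →
  ¬? (u ≟ u′) ×-dec ¬? (v ≟ v′) ×-dec
  χ u v ≟ c ×-dec χ u′ v ≟ c ×-dec χ u′ v′ ≟ c ×-dec χ u v′ ≟ c

colourClass : ∀ {k b} → EdgeColouring k b → Fin k → Fin b → Fin b → Bool
colourClass χ c u v = does (χ u v ≟ c)

does-≟⇒≡ : ∀ {k} (i j : Fin k) → does (i ≟ j) ≡ true → i ≡ j
does-≟⇒≡ i j eq with yes i≡j ← i ≟ j = i≡j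

colourClass-C₄-Free : ∀ {k b} (χ : EdgeColouring k b) → ¬ HasMonochromaticC₄ χ →
  ∀ c → C₄-Free (colourClass χ c)
colourClass-C₄-Free χ noC₄ c u u′ v v′ u≢u′ v≢v′ uv u′v uv′ u′v′ = noC₄
  ( u , u′ , v , v′ , c , u≢u′ , v≢v′
  , does-≟⇒≡ _ _ uv , does-≟⇒≡ _ _ u′v , does-≟⇒≡ _ _ u′v′ , does-≟⇒≡ _ _ uv′ )

-- With the sum over colours moved innermost, each edge contributes 1, having exactly one colour.
∑-edges-colourClass : ∀ {k b} (χ : EdgeColouring k b) → ∑[ c < k ] edges (colourClass χ c) ≡ b * b
∑-edges-colourClass {k} {b} χ = begin
  ∑[ c < k ] ∑[ u < b ] ∑[ v < b ] 𝟙 (colourClass χ c u v)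
    ≡⟨ ∑-comm (λ c u → ∑[ v < b ] 𝟙 (colourClass χ c u v)) ⟩
  ∑[ u < b ] ∑[ c < k ] ∑[ v < b ] 𝟙 (colourClass χ c u v)
    ≡⟨ sum-cong-≗ (λ u → ∑-comm λ c v → 𝟙 (colourClass χ c u v)) ⟩
  ∑[ u < b ] ∑[ v < b ] ∑[ c < k ] 𝟙 (colourClass χ c u v)
    ≡⟨ sum-cong-≗ (λ u → sum-cong-≗ λ v → ∑-𝟙-≟ (χ u v)) ⟩
  ∑[ u < b ] ∑[ v < b ] 1
    ≡⟨ sum-cong-≗ {b} (λ _ → trans (∑-const b 1) (*-identityʳ b)) ⟩
  ∑[ u < b ] b
    ≡⟨ ∑-const b b ⟩
  b * b ∎
  where open ≡-Reasoning

unavoidable-4-19 : Unavoidable 4 19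
-- Decidability of the finite search turns the refutation of `noC₄` into an actual cycle.
unavoidable-4-19 χ = decidable-stable (hasMonochromaticC₄? χ) λ noC₄ →
  <⇒≱ (from-yes (360 <? 361)) (subst (_≤ 360) (∑-edges-colourClass χ) (∑-≤-const 90 (edges≤90 noC₄)))
  where
  edges≤90 : ¬ HasMonochromaticC₄ χ → ∀ c → edges (colourClass χ c) ≤ 90
  -- Here 728 = 8 · 91 and 722 = 19 · 18 + 19 · 20. The choice d = 4 fits the mean degree 19 / 4 of
  -- an average colour class, as `tangent` is an equality at 4 and 5.
  edges≤90 noC₄ c = ≮⇒≥ λ 90<e → <⇒≱ (from-yes (722 <? 728))
    (≤-trans (*-monoʳ-≤ 8 90<e) (C₄-Free⇒edges-≤ (colourClass χ c) (colourClass-C₄-Free χ noC₄ c) 4))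

-- Restrict the colouring to the first `m` vertices on each side. This reduces minimality to the
-- single size 18.
unavoidable-mono : ∀ {k m n} → m ≤ n → Unavoidable k m → Unavoidable k n
unavoidable-mono m≤n unavoidable χ
  with u , u′ , v , v′ , c , u≢u′ , v≢v′ , mono ← unavoidable (λ u v → χ (inject≤ u m≤n) (inject≤ v m≤n)) =
  inject≤ u m≤n , inject≤ u′ m≤n , inject≤ v m≤n , inject≤ v′ m≤n , c ,
  u≢u′ ∘ inject≤-injective m≤n m≤n u u′ , v≢v′ ∘ inject≤-injective m≤n m≤n v v′ , mono

-- The colouring of K_{18,18}

infixl 6 _⊖_

-- Subtraction in ℤ₃.
_⊖_ : Fin 3 → Fin 3 → Fin 3
i  ⊖ 0F = i
0F ⊖ 1F = 2F
1F ⊖ 1F = 0F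
2F ⊖ 1F = 1F
0F ⊖ 2F = 1F
1F ⊖ 2F = 2F
2F ⊖ 2F = 0F

-- Found by computer search among the ℤ₃ × ℤ₃-invariant colourings in which every
-- colour occurs 3, 3, 2 and 1 times in the four blocks, hence on 81 edges.
block : Fin 2 → Fin 2 → Vec (Vec (Fin 4) 3) 3
block 0F 0F = (0F ∷ 0F ∷ 1F ∷ []) ∷ (0F ∷ 1F ∷ 1F ∷ []) ∷ (2F ∷ 3F ∷ 2F ∷ []) ∷ []
block 0F 1F = (0F ∷ 1F ∷ 2F ∷ []) ∷ (2F ∷ 0F ∷ 3F ∷ []) ∷ (3F ∷ 3F ∷ 2F ∷ []) ∷ []
block 1F 0F = (0F ∷ 1F ∷ 2F ∷ []) ∷ (3F ∷ 3F ∷ 2F ∷ []) ∷ (1F ∷ 2F ∷ 3F ∷ []) ∷ []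
block 1F 1F = (3F ∷ 1F ∷ 1F ∷ []) ∷ (2F ∷ 1F ∷ 0F ∷ []) ∷ (3F ∷ 0F ∷ 0F ∷ []) ∷ []

-- A vertex 9i + 3a₁ + a₂ stands for the element (a₁ , a₂) of the i-th copy of ℤ₃ × ℤ₃.
χ₁₈ : EdgeColouring 4 18
χ₁₈ u v =
  let i , a = remQuot 9 u ; a₁ , a₂ = remQuot {3} 3 a
      j , b = remQuot 9 v ; b₁ , b₂ = remQuot {3} 3 b
  -- Within a block only the difference b - a matters, whence the invariance under simultaneous
  -- translation.
  in lookup (lookup (block i j) (b₁ ⊖ a₁)) (b₂ ⊖ a₂)

-- The hypotheses are interleaved with the quantifiers so that the exhaustive
-- check prunes early.
χ₁₈-noC₄ : ∀ u u′ → u ≢ u′ → ∀ v → χ₁₈ u′ v ≡ χ₁₈ u v →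
  ∀ v′ → v ≢ v′ → χ₁₈ u v′ ≡ χ₁₈ u v → χ₁₈ u′ v′ ≢ χ₁₈ u v
χ₁₈-noC₄ = from-yes
  (all? λ u → all? λ u′ → ¬? (u ≟ u′) →-dec all? λ v → χ₁₈ u′ v ≟ χ₁₈ u v →-dec
   all? λ v′ → ¬? (v ≟ v′) →-dec χ₁₈ u v′ ≟ χ₁₈ u v →-dec ¬? (χ₁₈ u′ v′ ≟ χ₁₈ u v))

avoidable-4-18 : ¬ Unavoidable 4 18
avoidable-4-18 unavoidable
  with u , u′ , v , v′ , c , u≢u′ , v≢v′ , uv , u′v , u′v′ , uv′ ← unavoidable χ₁₈ =
  χ₁₈-noC₄ u u′ u≢u′ v (trans u′v (sym uv)) v′ v≢v′ (trans uv′ (sym uv)) (trans u′v′ (sym uv))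

theorem9 : IsBipartiteRamseyNumber 4 19
theorem9 = record
  { positive    = s≤s z≤n
  ; unavoidable = unavoidable-4-19
  ; least       = λ m _ unavoidable → ≮⇒≥ λ { (s≤s m≤18) →
      avoidable-4-18 (unavoidable-mono m≤18 unavoidable) }
  }
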